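{- Wallis's formula holds: $$\frac{\pi}{2} \ = \ \prod_{n=1}^\infty \frac{2n\cdot 2n}{(2n-1)(2n+1)}.$$
   Context: The infinite product is understood as the limit, as $m\to\infty$, of the partial products $\prod_{n=1}^m \frac{2n\cdot 2n}{(2n-1)(2n+1)}$. -}

module Defs where

open import Data.Bool.Base using (if_then_else_)
open import Data.Integer.Base as ℤ using (+_)
import Data.Integer.Properties as ℤ
open import Data.List.Base using (List; []; _∷_; _++_; length; filter; map; upTo; applyUpTo; cartesianProduct)
open import Data.List.Properties using (filter-++; length-++; map-applyUpTo)
open import Data.Nat.Base as ℕ using (ℕ; zero; suc; z≤n; s≤s)
import Data.Nat.Properties as ℕ
import Data.Nat.Solver as ℕ
open import Data.Product.Base using (_×_; _,_; ∃-syntax; proj₁; proj₂)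
open import Data.Rational.Base
open import Data.Rational.Properties
open import Data.Rational.Solver using (module +-*-Solver)
import Data.Rational.Unnormalised.Base as ℚᵘ
import Data.Rational.Unnormalised.Properties as ℚᵘ
open import Data.Sum.Base using (inj₁; inj₂)
open import Function.Base using (_∘_; id)
open import Relation.Binary.PropositionalEquality using (_≡_; refl; sym; trans; cong; cong₂; subst; subst₂)
open import Relation.Nullary.Decidable using (Dec; yes; no; does)
open import Relation.Nullary.Negation using (contradiction)

∣-∣≤ : ∀ {p q ε} → p ≤ q + ε → q ≤ p + ε → ∣ p - q ∣ ≤ ε
∣-∣≤ {p} {q} {ε} p≤q+ε q≤p+ε with ∣p∣≡p∨∣p∣≡-p (p - q)
... | inj₁ eq = begin
  ∣ p - q ∣      ≡⟨ eq ⟩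
  p - q          ≤⟨ +-monoˡ-≤ (- q) p≤q+ε ⟩
  (q + ε) - q    ≡⟨ solve 2 (λ q ε → (q :+ ε) :- q := ε) refl q ε ⟩
  ε              ∎
  where open ≤-Reasoning; open +-*-Solver
... | inj₂ eq = begin
  ∣ p - q ∣      ≡⟨ eq ⟩
  - (p - q)      ≡⟨ solve 2 (λ p q → :- (p :- q) := q :- p) refl p q ⟩
  q - p          ≤⟨ +-monoˡ-≤ (- p) q≤p+ε ⟩
  (p + ε) - p    ≡⟨ solve 2 (λ p ε → (p :+ ε) :- p := ε) refl p ε ⟩
  ε              ∎
  where open ≤-Reasoning; open +-*-Solver

∣∣-lipschitz : ∀ p q → ∣ ∣ p ∣ - ∣ q ∣ ∣ ≤ ∣ p - q ∣
∣∣-lipschitz p q = ∣-∣≤ (half p q) (subst (λ r → ∣ q ∣ ≤ ∣ p ∣ + r) flip (half q p))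
  where
  open +-*-Solver
  half : ∀ a b → ∣ a ∣ ≤ ∣ b ∣ + ∣ a - b ∣
  half a b = subst (λ c → ∣ c ∣ ≤ ∣ b ∣ + ∣ a - b ∣)
    (solve 2 (λ a b → b :+ (a :- b) := a) refl a b) (∣p+q∣≤∣p∣+∣q∣ b (a - b))
  flip : ∣ q - p ∣ ≡ ∣ p - q ∣
  flip = trans (cong ∣_∣ (solve 2 (λ p q → q :- p := :- (p :- q)) refl p q)) (∣-p∣≡∣p∣ (p - q))

½+½ : ∀ ε → ½ * ε + ½ * ε ≡ ε
½+½ ε = trans (sym (*-distribʳ-+ ε ½ ½)) (*-identityˡ ε)

½*-pos : ∀ {ε} → 0ℚ < ε → 0ℚ < ½ * ε
½*-pos {ε} 0<ε = subst (_< ½ * ε) (*-zeroʳ ½) (*-monoʳ-<-pos ½ 0<ε)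

/-mono-≤ : ∀ a b c d .{{_ : ℕ.NonZero b}} .{{_ : ℕ.NonZero d}} →
           a ℕ.* d ℕ.≤ c ℕ.* b → + a / b ≤ + c / d
/-mono-≤ a (suc b) c (suc d) h = toℚᵘ-cancel-≤ (begin
  toℚᵘ (+ a / suc b)  ≃⟨ toℚᵘ-fromℚᵘ (ℚᵘ.mkℚᵘ (+ a) b) ⟩
  ℚᵘ.mkℚᵘ (+ a) b     ≤⟨ ℚᵘ.*≤* (subst₂ ℤ._≤_ (ℤ.pos-* a (suc d)) (ℤ.pos-* c (suc b)) (ℤ.+≤+ h)) ⟩
  ℚᵘ.mkℚᵘ (+ c) d     ≃⟨ toℚᵘ-fromℚᵘ (ℚᵘ.mkℚᵘ (+ c) d) ⟨
  toℚᵘ (+ c / suc d)  ∎)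
  where open ℚᵘ.≤-Reasoning

/-homo-+ : ∀ a b d .{{_ : ℕ.NonZero d}} → + a / d + + b / d ≡ + (a ℕ.+ b) / d
/-homo-+ a b (suc d) = toℚᵘ-injective (begin
  toℚᵘ (+ a / suc d + + b / suc d)            ≈⟨ toℚᵘ-homo-+ (+ a / suc d) (+ b / suc d) ⟩
  toℚᵘ (+ a / suc d) ℚᵘ.+ toℚᵘ (+ b / suc d)  ≈⟨ ℚᵘ.+-cong (toℚᵘ-fromℚᵘ (ℚᵘ.mkℚᵘ (+ a) d)) (toℚᵘ-fromℚᵘ (ℚᵘ.mkℚᵘ (+ b) d)) ⟩
  ℚᵘ.mkℚᵘ (+ a) d ℚᵘ.+ ℚᵘ.mkℚᵘ (+ b) d        ≈⟨ ℚᵘ.*≡* eq ⟩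
  ℚᵘ.mkℚᵘ (+ (a ℕ.+ b)) d                     ≈⟨ toℚᵘ-fromℚᵘ (ℚᵘ.mkℚᵘ (+ (a ℕ.+ b)) d) ⟨
  toℚᵘ (+ (a ℕ.+ b) / suc d)                  ∎)
  where
  open import Relation.Binary.Reasoning.Setoid ℚᵘ.≃-setoid
  D = + suc d
  eq : (+ a ℤ.* D ℤ.+ + b ℤ.* D) ℤ.* D ≡ + (a ℕ.+ b) ℤ.* (D ℤ.* D)
  eq = trans (cong (ℤ._* D) (sym (ℤ.*-distribʳ-+ D (+ a) (+ b))))
             (ℤ.*-assoc (+ (a ℕ.+ b)) D D)

-- Cauchy sequences of rationals.  All relations below depend only on the
-- limiting behaviour of approx, so they respect equality of reals.
record ℝ : Set where
  field
    approx : ℕ → ℚ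
    cauchy : ∀ ε → 0ℚ < ε → ∃[ N ] ∀ m n → N ℕ.≤ m → N ℕ.≤ n →
             ∣ approx m - approx n ∣ ≤ ε

open ℝ public

infix  4 _<ℝ_ _≤ℝ_ _⟶_
infixl 6 _-ℝ_
infixr 7 _·_

_≤ℝ_ : ℝ → ℝ → Set
x ≤ℝ y = ∀ ε → 0ℚ < ε → ∃[ N ] ∀ n → N ℕ.≤ n → approx x n ≤ approx y n + ε

_<ℝ_ : ℝ → ℝ → Set
x <ℝ y = ∃[ ε ] 0ℚ < ε × ∃[ N ] ∀ n → N ℕ.≤ n → approx x n + ε ≤ approx y n

fromℚ : ℚ → ℝ
fromℚ q .approx _ = q
fromℚ q .cauchy ε 0<ε = 0 , λ _ _ _ _ →
  subst (_≤ ε) (sym (cong ∣_∣ (+-inverseʳ q))) (<⇒≤ 0<ε)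

0ℝ : ℝ
0ℝ = fromℚ 0ℚ

_-ℝ_ : ℝ → ℝ → ℝ
(x -ℝ y) .approx n = approx x n - approx y n
(x -ℝ y) .cauchy ε 0<ε with cauchy x (½ * ε) (½*-pos 0<ε) | cauchy y (½ * ε) (½*-pos 0<ε)
... | M , p | N , q = M ℕ.⊔ N , λ m n h k → begin
  ∣ (approx x m - approx y m) - (approx x n - approx y n) ∣
    ≡⟨ cong ∣_∣ (solve 4 (λ a b c d → (a :- b) :- (c :- d) := (a :- c) :- (b :- d)) refl
                   (approx x m) (approx y m) (approx x n) (approx y n)) ⟩
  ∣ (approx x m - approx x n) - (approx y m - approx y n) ∣
    ≤⟨ ∣p-q∣≤∣p∣+∣q∣ (approx x m - approx x n) (approx y m - approx y n) ⟩
  ∣ approx x m - approx x n ∣ + ∣ approx y m - approx y n ∣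
    ≤⟨ +-mono-≤ (p m n (ℕ.m⊔n≤o⇒m≤o M N h) (ℕ.m⊔n≤o⇒m≤o M N k))
                (q m n (ℕ.m⊔n≤o⇒n≤o M N h) (ℕ.m⊔n≤o⇒n≤o M N k)) ⟩
  ½ * ε + ½ * ε
    ≡⟨ ½+½ ε ⟩
  ε ∎
  where open ≤-Reasoning; open +-*-Solver

∣_∣ℝ : ℝ → ℝ
∣ x ∣ℝ .approx n = ∣ approx x n ∣
∣ x ∣ℝ .cauchy ε 0<ε with cauchy x ε 0<ε
... | N , p = N , λ m n h k →
  ≤-trans (∣∣-lipschitz (approx x m) (approx x n)) (p m n h k)

_·_ : ℚ → ℝ → ℝ
(q · x) .approx n = q * approx x n
(q · x) .cauchy ε 0<ε with cauchy x δ 0<δ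
  module Scale where
  c : ℚ
  c = ∣ q ∣ + 1ℚ
  instance
    c-pos : Positive c
    c-pos = nonNeg+pos⇒pos ∣ q ∣ {{∣-∣-nonNeg q}} 1ℚ
    c-nonZero : NonZero c
    c-nonZero = pos⇒nonZero c
    1/c-pos : Positive (1/ c)
    1/c-pos = 1/pos⇒pos c
  δ : ℚ
  δ = (1/ c) * ε
  0<δ : 0ℚ < δ
  0<δ = subst (_< δ) (*-zeroʳ (1/ c)) (*-monoʳ-<-pos (1/ c) 0<ε)
... | N , p = N , λ m n h k → begin
  ∣ q * approx x m - q * approx x n ∣
    ≡⟨ cong ∣_∣ (solve 3 (λ q a b → q :* a :- q :* b := q :* (a :- b)) refl q (approx x m) (approx x n)) ⟩
  ∣ q * (approx x m - approx x n) ∣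
    ≡⟨ ∣p*q∣≡∣p∣*∣q∣ q (approx x m - approx x n) ⟩
  ∣ q ∣ * ∣ approx x m - approx x n ∣
    ≤⟨ *-monoˡ-≤-nonNeg ∣ q ∣ {{∣-∣-nonNeg q}} (p m n h k) ⟩
  ∣ q ∣ * δ
    ≤⟨ *-monoʳ-≤-nonNeg δ {{pos⇒nonNeg δ {{positive 0<δ}}}} ∣q∣≤c ⟩
  c * δ
    ≡⟨ *-assoc c (1/ c) ε ⟨
  c * (1/ c) * ε
    ≡⟨ cong (_* ε) (*-inverseʳ c) ⟩
  1ℚ * ε
    ≡⟨ *-identityˡ ε ⟩
  ε ∎
  where
  open Scale q x ε 0<ε
  open ≤-Reasoning; open +-*-Solver
  ∣q∣≤c : ∣ q ∣ ≤ ∣ q ∣ + 1ℚ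
  ∣q∣≤c = subst (_≤ ∣ q ∣ + 1ℚ) (+-identityʳ ∣ q ∣) (+-monoʳ-≤ ∣ q ∣ (nonNegative⁻¹ 1ℚ))

_⟶_ : (ℕ → ℝ) → ℝ → Set
x ⟶ l = ∀ ε → 0ℝ <ℝ ε → ∃[ M ] ∀ m → M ℕ.≤ m → ∣ x m -ℝ l ∣ℝ <ℝ ε

-- The quarter disc { (x , y) ∈ [0,1]² : x² + y² ≤ 1 } is approximated by the
-- closed squares [i/N , (i+1)/N] × [j/N , (j+1)/N] with 0 ≤ i , j < N.

-- A square lies in the disc iff its corner farthest from the origin does.
Inside : (N i j : ℕ) → Set
Inside N i j = suc i ℕ.* suc i ℕ.+ suc j ℕ.* suc j ℕ.≤ N ℕ.* N

inside? : ∀ N i j → Dec (Inside N i j)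
inside? N i j = _ ℕ.≤? _

-- A square meets the open disc iff its corner closest to the origin does.
Meets : (N i j : ℕ) → Set
Meets N i j = i ℕ.* i ℕ.+ j ℕ.* j ℕ.< N ℕ.* N

meets? : ∀ N i j → Dec (Meets N i j)
meets? N i j = _ ℕ.<? _

count : {P : ℕ → ℕ → Set} → (∀ i j → Dec (P i j)) → ℕ → ℕ
count P? N = length (filter (λ (i , j) → P? i j) (cartesianProduct (upTo N) (upTo N)))

insideCount : ℕ → ℕ
insideCount N = count (inside? N) N

meetsCount : ℕ → ℕ
meetsCount N = count (meets? N) N

-- Lower and upper approximations to the area of the full unit disc: it
-- consists of four congruent quarter discs, and each square has area 1/N².
innerArea outerArea : (N : ℕ) → .{{ℕ.NonZero N}} → ℚ
innerArea N = (+ (4 ℕ.* insideCount N) / (N ℕ.* N)) {{ℕ.m*n≢0 N N}}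
outerArea N = (+ (4 ℕ.* meetsCount N)  / (N ℕ.* N)) {{ℕ.m*n≢0 N N}}

∑ : (ℕ → ℕ) → ℕ → ℕ
∑ f zero    = 0
∑ f (suc n) = f 0 ℕ.+ ∑ (f ∘ suc) n

𝟙 : {P : Set} → Dec P → ℕ
𝟙 P? = if does P? then 1 else 0

𝟙-mono : {P Q : Set} (P? : Dec P) (Q? : Dec Q) → (P → Q) → 𝟙 P? ℕ.≤ 𝟙 Q?
𝟙-mono (no _)  _       _ = z≤n
𝟙-mono (yes _) (yes _) _ = ℕ.≤-refl
𝟙-mono (yes p) (no ¬q) h = contradiction (h p) ¬q

𝟙≤1 : {P : Set} (P? : Dec P) → 𝟙 P? ℕ.≤ 1
𝟙≤1 (no _)  = z≤n
𝟙≤1 (yes _) = ℕ.≤-refl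

count-∑ : {P : ℕ → ℕ → Set} (P? : ∀ i j → Dec (P i j)) (N : ℕ) →
          count P? N ≡ ∑ (λ i → ∑ (λ j → 𝟙 (P? i j)) N) N
count-∑ {P} P? N = rows id N
  where
  Q? : (x : ℕ × ℕ) → Dec (P (proj₁ x) (proj₂ x))
  Q? (i , j) = P? i j

  row : ∀ i (g : ℕ → ℕ) n →
        length (filter Q? (map (i ,_) (applyUpTo g n))) ≡ ∑ (λ j → 𝟙 (P? i (g j))) n
  row i g zero = refl
  row i g (suc n) with P? i (g 0)
  ... | yes _ = cong suc (row i (g ∘ suc) n)
  ... | no  _ = row i (g ∘ suc) n

  rows : ∀ (f : ℕ → ℕ) m →
         length (filter Q? (cartesianProduct (applyUpTo f m) (upTo N))) ≡
         ∑ (λ i → ∑ (λ j → 𝟙 (P? (f i) j)) N) m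
  rows f zero = refl
  rows f (suc m) = trans
    (cong length (filter-++ Q? (map (f 0 ,_) (upTo N)) _))
    (trans (length-++ (filter Q? (map (f 0 ,_) (upTo N))))
           (cong₂ ℕ._+_ (row (f 0) id N) (rows (f ∘ suc) m)))

∑-mono : ∀ {f g} n → (∀ i → f i ℕ.≤ g i) → ∑ f n ℕ.≤ ∑ g n
∑-mono zero    h = z≤n
∑-mono (suc n) h = ℕ.+-mono-≤ (h 0) (∑-mono n (h ∘ suc))

∑-const-≥ : ∀ {f} c n → (∀ i → i ℕ.< n → c ℕ.≤ f i) → n ℕ.* c ℕ.≤ ∑ f n
∑-const-≥ c zero    h = z≤n
∑-const-≥ c (suc n) h = ℕ.+-mono-≤ (h 0 (s≤s z≤n)) (∑-const-≥ c n (λ i i<n → h (suc i) (s≤s i<n)))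

∑-const-≤ : ∀ {f} c n → (∀ i → i ℕ.< n → f i ℕ.≤ c) → ∑ f n ℕ.≤ n ℕ.* c
∑-const-≤ c zero    h = z≤n
∑-const-≤ c (suc n) h = ℕ.+-mono-≤ (h 0 (s≤s z≤n)) (∑-const-≤ c n (λ i i<n → h (suc i) (s≤s i<n)))

∑-+ : ∀ f g n → ∑ (λ i → f i ℕ.+ g i) n ≡ ∑ f n ℕ.+ ∑ g n
∑-+ f g zero    = refl
∑-+ f g (suc n) = trans (cong (f 0 ℕ.+ g 0 ℕ.+_) (∑-+ (f ∘ suc) (g ∘ suc) n))
  (solve 4 (λ a b c d → a :+ b :+ (c :+ d) := a :+ c :+ (b :+ d)) refl (f 0) (g 0) _ _)
  where open ℕ.+-*-Solver

∑-* : ∀ k f n → ∑ (λ i → k ℕ.* f i) n ≡ k ℕ.* ∑ f n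
∑-* k f zero    = sym (ℕ.*-zeroʳ k)
∑-* k f (suc n) = trans (cong (k ℕ.* f 0 ℕ.+_) (∑-* k (f ∘ suc) n)) (sym (ℕ.*-distribˡ-+ k (f 0) _))

∑-split : ∀ f m n → ∑ f (m ℕ.+ n) ≡ ∑ f m ℕ.+ ∑ (λ i → f (m ℕ.+ i)) n
∑-split f zero    n = refl
∑-split f (suc m) n = trans (cong (f 0 ℕ.+_) (∑-split (f ∘ suc) m n)) (sym (ℕ.+-assoc (f 0) _ _))

∑-suc-≥ : ∀ f n → ∑ f n ℕ.≤ ∑ f (suc n)
∑-suc-≥ f zero    = z≤n
∑-suc-≥ f (suc n) = ℕ.+-monoʳ-≤ (f 0) (∑-suc-≥ (f ∘ suc) n)

∑-blocks-≥ : ∀ {f g} k N → (∀ i r → r ℕ.< k → g i ℕ.≤ f (i ℕ.* k ℕ.+ r)) →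
             k ℕ.* ∑ g N ℕ.≤ ∑ f (N ℕ.* k)
∑-blocks-≥ {f} {g} k zero    h = ℕ.≤-reflexive (ℕ.*-zeroʳ k)
∑-blocks-≥ {f} {g} k (suc N) h = begin
  k ℕ.* (g 0 ℕ.+ ∑ (g ∘ suc) N)                    ≡⟨ ℕ.*-distribˡ-+ k (g 0) _ ⟩
  k ℕ.* g 0 ℕ.+ k ℕ.* ∑ (g ∘ suc) N                ≤⟨ ℕ.+-mono-≤ (∑-const-≥ (g 0) k (h 0))
                                                        (∑-blocks-≥ k N λ i r r<k →
                                                          subst (λ x → g (suc i) ℕ.≤ f x) (ℕ.+-assoc k (i ℕ.* k) r) (h (suc i) r r<k)) ⟩
  ∑ f k ℕ.+ ∑ (λ i → f (k ℕ.+ i)) (N ℕ.* k)        ≡⟨ ∑-split f k (N ℕ.* k) ⟨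
  ∑ f (k ℕ.+ N ℕ.* k)                              ∎
  where open ℕ.≤-Reasoning

∑-blocks-≤ : ∀ {f g} k N → (∀ i r → r ℕ.< k → f (i ℕ.* k ℕ.+ r) ℕ.≤ g i) →
             ∑ f (N ℕ.* k) ℕ.≤ k ℕ.* ∑ g N
∑-blocks-≤ {f} {g} k zero    h = z≤n
∑-blocks-≤ {f} {g} k (suc N) h = begin
  ∑ f (k ℕ.+ N ℕ.* k)                              ≡⟨ ∑-split f k (N ℕ.* k) ⟩
  ∑ f k ℕ.+ ∑ (λ i → f (k ℕ.+ i)) (N ℕ.* k)        ≤⟨ ℕ.+-mono-≤ (∑-const-≤ (g 0) k (h 0))
                                                        (∑-blocks-≤ k N λ i r r<k →
                                                          subst (λ x → f x ℕ.≤ g (suc i)) (ℕ.+-assoc k (i ℕ.* k) r) (h (suc i) r r<k)) ⟩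
  k ℕ.* g 0 ℕ.+ k ℕ.* ∑ (g ∘ suc) N                ≡⟨ ℕ.*-distribˡ-+ k (g 0) _ ⟨
  k ℕ.* (g 0 ℕ.+ ∑ (g ∘ suc) N)                    ∎
  where open ℕ.≤-Reasoning

module _ {P Q : ℕ → ℕ → Set} (P? : ∀ i j → Dec (P i j)) (Q? : ∀ i j → Dec (Q i j)) where

  count-refine-≥ : ∀ k N → (∀ i j r s → r ℕ.< k → s ℕ.< k → P i j → Q (i ℕ.* k ℕ.+ r) (j ℕ.* k ℕ.+ s)) →
                   k ℕ.* (k ℕ.* count P? N) ℕ.≤ count Q? (N ℕ.* k)
  count-refine-≥ k N h = begin
    k ℕ.* (k ℕ.* count P? N)                            ≡⟨ cong (λ x → k ℕ.* (k ℕ.* x)) (count-∑ P? N) ⟩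
    k ℕ.* (k ℕ.* ∑ (λ i → ∑ (λ j → 𝟙 (P? i j)) N) N)    ≡⟨ cong (k ℕ.*_) (∑-* k _ N) ⟨
    k ℕ.* ∑ (λ i → k ℕ.* ∑ (λ j → 𝟙 (P? i j)) N) N      ≤⟨ ∑-blocks-≥ k N (λ i r r<k →
                                                             ∑-blocks-≥ k N λ j s s<k →
                                                               𝟙-mono (P? i j) (Q? _ _) (h i j r s r<k s<k)) ⟩
    ∑ (λ i → ∑ (λ j → 𝟙 (Q? i j)) (N ℕ.* k)) (N ℕ.* k)  ≡⟨ count-∑ Q? (N ℕ.* k) ⟨
    count Q? (N ℕ.* k)                                  ∎
    where open ℕ.≤-Reasoning

  count-refine-≤ : ∀ k N → (∀ i j r s → r ℕ.< k → s ℕ.< k → Q (i ℕ.* k ℕ.+ r) (j ℕ.* k ℕ.+ s) → P i j) →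
                   count Q? (N ℕ.* k) ℕ.≤ k ℕ.* (k ℕ.* count P? N)
  count-refine-≤ k N h = begin
    count Q? (N ℕ.* k)                                  ≡⟨ count-∑ Q? (N ℕ.* k) ⟩
    ∑ (λ i → ∑ (λ j → 𝟙 (Q? i j)) (N ℕ.* k)) (N ℕ.* k)  ≤⟨ ∑-blocks-≤ k N (λ i r r<k →
                                                             ∑-blocks-≤ k N λ j s s<k →
                                                               𝟙-mono (Q? _ _) (P? i j) (h i j r s r<k s<k)) ⟩
    k ℕ.* ∑ (λ i → k ℕ.* ∑ (λ j → 𝟙 (P? i j)) N) N      ≡⟨ cong (k ℕ.*_) (∑-* k _ N) ⟩
    k ℕ.* (k ℕ.* ∑ (λ i → ∑ (λ j → 𝟙 (P? i j)) N) N)    ≡⟨ cong (λ x → k ℕ.* (k ℕ.* x)) (count-∑ P? N) ⟨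
    k ℕ.* (k ℕ.* count P? N)                            ∎
    where open ℕ.≤-Reasoning

square-scale : ∀ a b k → (a ℕ.* k) ℕ.* (a ℕ.* k) ℕ.+ (b ℕ.* k) ℕ.* (b ℕ.* k) ≡ (a ℕ.* a ℕ.+ b ℕ.* b) ℕ.* (k ℕ.* k)
square-scale = solve 3 (λ a b k → (a :* k) :* (a :* k) :+ (b :* k) :* (b :* k) := (a :* a :+ b :* b) :* (k :* k)) refl
  where open ℕ.+-*-Solver

inside-refine : ∀ k N i j r s → r ℕ.< k → s ℕ.< k → Inside N i j →
                Inside (N ℕ.* k) (i ℕ.* k ℕ.+ r) (j ℕ.* k ℕ.+ s)
inside-refine k N i j r s r<k s<k h = begin
  suc x ℕ.* suc x ℕ.+ suc y ℕ.* suc y                                                      ≤⟨ ℕ.+-mono-≤ (ℕ.*-mono-≤ (bound i r r<k) (bound i r r<k)) (ℕ.*-mono-≤ (bound j s s<k) (bound j s s<k)) ⟩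
  (suc i ℕ.* k) ℕ.* (suc i ℕ.* k) ℕ.+ (suc j ℕ.* k) ℕ.* (suc j ℕ.* k)                      ≡⟨ square-scale (suc i) (suc j) k ⟩
  (suc i ℕ.* suc i ℕ.+ suc j ℕ.* suc j) ℕ.* (k ℕ.* k)                                      ≤⟨ ℕ.*-monoˡ-≤ (k ℕ.* k) h ⟩
  N ℕ.* N ℕ.* (k ℕ.* k)                                                                    ≡⟨ ℕ.[m*n]*[o*p]≡[m*o]*[n*p] N N k k ⟩
  (N ℕ.* k) ℕ.* (N ℕ.* k)                                                                  ∎
  where
  open ℕ.≤-Reasoning
  x = i ℕ.* k ℕ.+ r
  y = j ℕ.* k ℕ.+ s
  bound : ∀ i r → r ℕ.< k → suc (i ℕ.* k ℕ.+ r) ℕ.≤ suc i ℕ.* k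
  bound i r r<k = subst₂ ℕ._≤_ (ℕ.+-suc (i ℕ.* k) r) (ℕ.+-comm (i ℕ.* k) k) (ℕ.+-monoʳ-≤ (i ℕ.* k) r<k)

inside⇒meets : ∀ k N i j r s → Inside (N ℕ.* k) (i ℕ.* k ℕ.+ r) (j ℕ.* k ℕ.+ s) → Meets N i j
inside⇒meets k N i j r s h = ℕ.*-cancelʳ-< (k ℕ.* k) _ _ (begin-strict
  (i ℕ.* i ℕ.+ j ℕ.* j) ℕ.* (k ℕ.* k)                                ≡⟨ square-scale i j k ⟨
  (i ℕ.* k) ℕ.* (i ℕ.* k) ℕ.+ (j ℕ.* k) ℕ.* (j ℕ.* k)                ≤⟨ ℕ.+-mono-≤ (ℕ.*-mono-≤ (ℕ.m≤m+n (i ℕ.* k) r) (ℕ.m≤m+n (i ℕ.* k) r))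
                                                                                   (ℕ.*-mono-≤ (ℕ.m≤m+n (j ℕ.* k) s) (ℕ.m≤m+n (j ℕ.* k) s)) ⟩
  x ℕ.* x ℕ.+ y ℕ.* y                                                <⟨ ℕ.+-mono-< (ℕ.*-mono-< (ℕ.n<1+n x) (ℕ.n<1+n x)) (ℕ.*-mono-< (ℕ.n<1+n y) (ℕ.n<1+n y)) ⟩
  suc x ℕ.* suc x ℕ.+ suc y ℕ.* suc y                                ≤⟨ h ⟩
  (N ℕ.* k) ℕ.* (N ℕ.* k)                                            ≡⟨ ℕ.[m*n]*[o*p]≡[m*o]*[n*p] N N k k ⟨
  N ℕ.* N ℕ.* (k ℕ.* k)                                              ∎)
  where
  open ℕ.≤-Reasoning
  x = i ℕ.* k ℕ.+ r
  y = j ℕ.* k ℕ.+ s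

innerArea≤outerArea : ∀ M N .{{_ : ℕ.NonZero M}} .{{_ : ℕ.NonZero N}} → innerArea M ≤ outerArea N
innerArea≤outerArea M N = /-mono-≤ (4 ℕ.* insideCount M) (M ℕ.* M) (4 ℕ.* meetsCount N) (N ℕ.* N) {{ℕ.m*n≢0 M M}} {{ℕ.m*n≢0 N N}} (begin
  4 ℕ.* insideCount M ℕ.* (N ℕ.* N)      ≡⟨ rearrange (insideCount M) N ⟩
  4 ℕ.* (N ℕ.* (N ℕ.* insideCount M))    ≤⟨ ℕ.*-monoʳ-≤ 4 (count-refine-≥ (inside? M) (inside? (M ℕ.* N)) N M (inside-refine N M)) ⟩
  4 ℕ.* insideCount (M ℕ.* N)            ≡⟨ cong (λ K → 4 ℕ.* insideCount K) (ℕ.*-comm M N) ⟩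
  4 ℕ.* insideCount (N ℕ.* M)            ≤⟨ ℕ.*-monoʳ-≤ 4 (count-refine-≤ (meets? N) (inside? (N ℕ.* M)) M N (λ i j r s _ _ → inside⇒meets M N i j r s)) ⟩
  4 ℕ.* (M ℕ.* (M ℕ.* meetsCount N))     ≡⟨ rearrange (meetsCount N) M ⟨
  4 ℕ.* meetsCount N ℕ.* (M ℕ.* M)       ∎)
  where
  open ℕ.≤-Reasoning
  rearrange : ∀ c k → 4 ℕ.* c ℕ.* (k ℕ.* k) ≡ 4 ℕ.* (k ℕ.* (k ℕ.* c))
  rearrange = solve 2 (λ c k → con 4 :* c :* (k :* k) := con 4 :* (k :* (k :* c))) refl
    where open ℕ.+-*-Solver

meetsCount≤ : ∀ N → meetsCount N ℕ.≤ insideCount N ℕ.+ 2 ℕ.* N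
meetsCount≤ N = begin
  meetsCount N                             ≡⟨ count-∑ (meets? N) N ⟩
  ∑ (λ i → ∑ (m i) N) N                    ≤⟨ ∑-suc-≥ (λ i → ∑ (m i) N) N ⟩
  ∑ (m 0) N ℕ.+ ∑ (λ i → ∑ (m (suc i)) N) N
    ≤⟨ ℕ.+-mono-≤ (∑-const-≤ 1 N (λ j _ → 𝟙≤1 (meets? N 0 j)))
                  (∑-mono N λ i → ℕ.≤-trans (∑-suc-≥ (m (suc i)) N)
                                             (ℕ.+-monoˡ-≤ _ (𝟙≤1 (meets? N (suc i) 0)))) ⟩
  N ℕ.* 1 ℕ.+ ∑ (λ i → 1 ℕ.+ ∑ (λ j → m (suc i) (suc j)) N) N
    ≡⟨ cong (N ℕ.* 1 ℕ.+_) (∑-+ (λ _ → 1) _ N) ⟩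
  N ℕ.* 1 ℕ.+ (∑ (λ _ → 1) N ℕ.+ ∑ (λ i → ∑ (λ j → m (suc i) (suc j)) N) N)
    ≤⟨ ℕ.+-monoʳ-≤ (N ℕ.* 1) (ℕ.+-mono-≤ (∑-const-≤ 1 N (λ _ _ → ℕ.≤-refl))
         (∑-mono N λ i → ∑-mono N λ j → 𝟙-mono (meets? N (suc i) (suc j)) (inside? N i j) ℕ.<⇒≤)) ⟩
  N ℕ.* 1 ℕ.+ (N ℕ.* 1 ℕ.+ ∑ (λ i → ∑ (λ j → 𝟙 (inside? N i j)) N) N)
    ≡⟨ cong (λ x → N ℕ.* 1 ℕ.+ (N ℕ.* 1 ℕ.+ x)) (count-∑ (inside? N) N) ⟨
  N ℕ.* 1 ℕ.+ (N ℕ.* 1 ℕ.+ insideCount N)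
    ≡⟨ solve 2 (λ N c → N :* con 1 :+ (N :* con 1 :+ c) := c :+ con 2 :* N) refl N (insideCount N) ⟩
  insideCount N ℕ.+ 2 ℕ.* N                ∎
  where
  open ℕ.≤-Reasoning
  open ℕ.+-*-Solver
  m : ℕ → ℕ → ℕ
  m i j = 𝟙 (meets? N i j)

gap : ∀ ε → 0ℚ < ε → ∃[ K ] ∀ N .{{_ : ℕ.NonZero N}} → K ℕ.≤ N → outerArea N ≤ innerArea N + ε
gap ε@(mkℚ (+ zero) d _)        0<ε = contradiction 0<ε (<-irrefl (sym mkℚ-zero))
  where
  mkℚ-zero : ε ≡ 0ℚ
  mkℚ-zero = trans (sym (↥p/↧p≡p ε)) (0/n≡0 (suc d))
gap ε@(mkℚ ℤ.-[1+ p ] d _)      0<ε = contradiction (<-trans 0<ε (negative⁻¹ ε)) (<-irrefl refl)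
gap ε@(mkℚ (+ suc p) d _)       0<ε = 8 ℕ.* suc d , bound
  where
  bound : ∀ N .{{_ : ℕ.NonZero N}} → 8 ℕ.* suc d ℕ.≤ N → outerArea N ≤ innerArea N + ε
  bound N K≤N = begin
    outerArea N
      ≤⟨ /-mono-≤ (4 ℕ.* meetsCount N) (N ℕ.* N) (4 ℕ.* (insideCount N ℕ.+ 2 ℕ.* N)) (N ℕ.* N) (ℕ.*-monoˡ-≤ (N ℕ.* N) (ℕ.*-monoʳ-≤ 4 (meetsCount≤ N))) ⟩
    + (4 ℕ.* (insideCount N ℕ.+ 2 ℕ.* N)) / (N ℕ.* N)
      ≡⟨ cong (λ x → + x / (N ℕ.* N)) (solve 2 (λ c N → con 4 :* (c :+ con 2 :* N) := con 4 :* c :+ con 8 :* N) refl (insideCount N) N) ⟩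
    + (4 ℕ.* insideCount N ℕ.+ 8 ℕ.* N) / (N ℕ.* N)
      ≡⟨ /-homo-+ (4 ℕ.* insideCount N) (8 ℕ.* N) (N ℕ.* N) ⟨
    innerArea N + + (8 ℕ.* N) / (N ℕ.* N)
      ≤⟨ +-monoʳ-≤ (innerArea N) small ⟩
    innerArea N + ε ∎
    where
    open ≤-Reasoning
    open ℕ.+-*-Solver
    instance
      N*N≢0 : ℕ.NonZero (N ℕ.* N)
      N*N≢0 = ℕ.m*n≢0 N N
    crossed : 8 ℕ.* N ℕ.* suc d ℕ.≤ suc p ℕ.* (N ℕ.* N)
    crossed = ℕ.≤-trans
      (ℕ.≤-reflexive (solve 2 (λ N d → con 8 :* N :* d := con 8 :* d :* N) refl N (suc d)))
      (ℕ.≤-trans (ℕ.*-monoˡ-≤ N K≤N) (ℕ.m≤m+n (N ℕ.* N) (p ℕ.* (N ℕ.* N))))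
    small : + (8 ℕ.* N) / (N ℕ.* N) ≤ ε
    small = subst (+ (8 ℕ.* N) / (N ℕ.* N) ≤_) (↥p/↧p≡p ε) (/-mono-≤ (8 ℕ.* N) (N ℕ.* N) (suc p) (suc d) crossed)

innerArea≤innerArea+ε : ∀ ε → 0ℚ < ε → ∃[ K ] ∀ M N .{{_ : ℕ.NonZero M}} .{{_ : ℕ.NonZero N}} →
                        K ℕ.≤ N → innerArea M ≤ innerArea N + ε
innerArea≤innerArea+ε ε 0<ε = proj₁ g , λ M N K≤N → ≤-trans (innerArea≤outerArea M N) (proj₂ g N K≤N)
  where g = gap ε 0<ε

-- π is the area of the unit disc, as the limit of the areas of the inner
-- approximations.  By innerArea≤π and π≤outerArea below it is squeezed
-- between the inner and the outer ones, which agree in the limit by gap.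
π : ℝ
π .approx n = innerArea (suc n)
π .cauchy ε 0<ε = proj₁ g , λ m n K≤m K≤n →
  ∣-∣≤ (proj₂ g (suc m) (suc n) (ℕ.m≤n⇒m≤1+n K≤n)) (proj₂ g (suc n) (suc m) (ℕ.m≤n⇒m≤1+n K≤m))
  where g = innerArea≤innerArea+ε ε 0<ε

innerArea≤π : ∀ N .{{_ : ℕ.NonZero N}} → fromℚ (innerArea N) ≤ℝ π
innerArea≤π N ε 0<ε = proj₁ g , λ n K≤n → proj₂ g N (suc n) (ℕ.m≤n⇒m≤1+n K≤n)
  where g = innerArea≤innerArea+ε ε 0<ε

π≤outerArea : ∀ N .{{_ : ℕ.NonZero N}} → π ≤ℝ fromℚ (outerArea N)
π≤outerArea N ε 0<ε = 0 , λ n _ →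
  ≤-trans {innerArea (suc n)} {outerArea N} {outerArea N + ε} (innerArea≤outerArea (suc n) N)
          (subst (_≤ outerArea N + ε) (+-identityʳ (outerArea N)) (+-monoʳ-≤ (outerArea N) (<⇒≤ 0<ε)))

-- As n ≥ 1, the truncated subtraction 2 * n ∸ 1 is the true one.
wallisFactor : (n : ℕ) → .{{ℕ.NonZero n}} → ℚ
wallisFactor n@(suc k) = + ((2 ℕ.* n) ℕ.* (2 ℕ.* n)) / ((2 ℕ.* n ℕ.∸ 1) ℕ.* (2 ℕ.* n ℕ.+ 1))
  where
  instance
    2n∸1≢0 : ℕ.NonZero (2 ℕ.* n ℕ.∸ 1)
    2n∸1≢0 = ℕ.≢-nonZero (λ eq → contradiction (trans (sym (ℕ.+-suc k (k ℕ.+ 0))) eq) λ ())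
    denominator≢0 : ℕ.NonZero ((2 ℕ.* n ℕ.∸ 1) ℕ.* (2 ℕ.* n ℕ.+ 1))
    denominator≢0 = ℕ.m*n≢0 (2 ℕ.* n ℕ.∸ 1) (2 ℕ.* n ℕ.+ 1)

wallisProduct : ℕ → ℚ
wallisProduct zero    = 1ℚ
wallisProduct (suc m) = wallisProduct m * wallisFactor (suc m)

{-# OPTIONS --safe #-}

-- Wästlund's argument.  Let a_k = (1/2)(3/4)⋯((2k-1)/(2k)) and
-- s_k = a_0 + ⋯ + a_{k-1} = 2k a_k.  Cut the quadrant by the lines x = s_i and
-- y = s_j.  The antidiagonal sums of the a_i a_j all equal 1, so the staircase
-- of the cells (i , j) with i + j < n has area n.  As s_k² / k increases and
-- s_k² / (2k-1) decreases, i + j = n implies s_{n-1}² ≤ s_i² + s_j² ≤ s_n²,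
-- so the staircase contains the quarter disc of radius s_{n-1} and is contained
-- in that of radius s_{n+1}.  The m-th partial Wallis product is
-- (2m+1) / s_{m+1}², whence it differs from π/2 by at most 3 / s_{m+1}².
-- Everything is scaled by a common denominator of a_0, …, a_N, which turns the
-- staircase into a set of unit squares to be counted.
module Submission where

import Data.Integer.Base as ℤ
import Data.Integer.Properties as ℤ
open import Data.Nat.Base hiding (_/_)
open import Data.Nat.Properties
open import Data.Nat.Solver using (module +-*-Solver)
open import Data.Product.Base using (_×_; _,_; ∃-syntax; proj₁; proj₂)
open import Data.Rational.Base as ℚ using (ℚ; mkℚ; 0ℚ; ½; _/_)
import Data.Rational.Properties as ℚ
import Data.Rational.Unnormalised.Base as ℚᵘ
import Data.Rational.Unnormalised.Properties as ℚᵘ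
open import Defs
open import Function.Base using (_∘_)
open import Relation.Binary.PropositionalEquality
open import Relation.Nullary.Decidable using (Dec; yes; no)
open import Relation.Nullary.Negation using (contradiction)

-- Arithmetic of fractions

/-cross : ∀ a b c d .{{_ : NonZero b}} .{{_ : NonZero d}} → a * d ≡ c * b → ℤ.+ a / b ≡ ℤ.+ c / d
/-cross a b c d eq =
  ℚ.≤-antisym (/-mono-≤ a b c d (≤-reflexive eq)) (/-mono-≤ c d a b (≤-reflexive (sym eq)))

/-*-/ : ∀ a b c d e f .{{_ : NonZero b}} .{{_ : NonZero d}} .{{_ : NonZero f}} →
        a * c * f ≡ e * (b * d) → (ℤ.+ a / b) ℚ.* (ℤ.+ c / d) ≡ ℤ.+ e / f
/-*-/ a (suc b) c (suc d) e (suc f) eq = ℚ.toℚᵘ-injective (begin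
  ℚ.toℚᵘ ((ℤ.+ a / suc b) ℚ.* (ℤ.+ c / suc d))              ≈⟨ ℚ.toℚᵘ-homo-* (ℤ.+ a / suc b) (ℤ.+ c / suc d) ⟩
  ℚ.toℚᵘ (ℤ.+ a / suc b) ℚᵘ.* ℚ.toℚᵘ (ℤ.+ c / suc d)
    ≈⟨ ℚᵘ.*-cong (ℚ.toℚᵘ-fromℚᵘ (ℚᵘ.mkℚᵘ (ℤ.+ a) b)) (ℚ.toℚᵘ-fromℚᵘ (ℚᵘ.mkℚᵘ (ℤ.+ c) d)) ⟩
  ℚᵘ.mkℚᵘ (ℤ.+ a) b ℚᵘ.* ℚᵘ.mkℚᵘ (ℤ.+ c) d                  ≈⟨ ℚᵘ.*≡* cross ⟩
  ℚᵘ.mkℚᵘ (ℤ.+ e) f                                         ≈⟨ ℚ.toℚᵘ-fromℚᵘ (ℚᵘ.mkℚᵘ (ℤ.+ e) f) ⟨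
  ℚ.toℚᵘ (ℤ.+ e / suc f)                                    ∎)
  where
  open import Relation.Binary.Reasoning.Setoid ℚᵘ.≃-setoid
  cross : ℤ.+ a ℤ.* ℤ.+ c ℤ.* ℤ.+ suc f ≡ ℤ.+ e ℤ.* ℤ.+ (suc b * suc d)
  cross = trans (cong (ℤ._* ℤ.+ suc f) (sym (ℤ.pos-* a c)))
    (trans (sym (ℤ.pos-* (a * c) (suc f))) (trans (cong ℤ.+_ eq) (ℤ.pos-* e (suc b * suc d))))

½*4n/d : ∀ n d .{{_ : NonZero d}} → ½ ℚ.* (ℤ.+ (4 * n) / d) ≡ ℤ.+ (2 * n) / d
½*4n/d n d = /-*-/ 1 2 (4 * n) d (2 * n) d
  (solve 2 (λ n d → con 1 :* (con 4 :* n) :* d := con 2 :* n :* (con 2 :* d)) refl n d)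
  where open +-*-Solver

-- Sums and convolutions

∑-cong : ∀ {f g} n → (∀ i → i < n → f i ≡ g i) → ∑ f n ≡ ∑ g n
∑-cong zero    h = refl
∑-cong (suc n) h = cong₂ _+_ (h 0 z<s) (∑-cong n λ i i<n → h (suc i) (s<s i<n))

∑-snoc : ∀ f n → ∑ f (suc n) ≡ ∑ f n + f n
∑-snoc f zero    = +-identityʳ (f 0)
∑-snoc f (suc n) = trans (cong (f 0 +_) (∑-snoc (f ∘ suc) n)) (sym (+-assoc (f 0) _ _))

∑-monoʳ-≤ : ∀ f {m n} → m ≤ n → ∑ f m ≤ ∑ f n
∑-monoʳ-≤ f z≤n       = z≤n
∑-monoʳ-≤ f (s≤s m≤n) = +-monoʳ-≤ (f 0) (∑-monoʳ-≤ (f ∘ suc) m≤n)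

∑-𝟙-≤ : ∀ {P : ℕ → Set} (P? : ∀ i → Dec (P i)) n t → (∀ i → P i → i < t) →
        ∑ (λ i → 𝟙 (P? i)) n ≤ t
∑-𝟙-≤ P? zero    t       h = z≤n
∑-𝟙-≤ P? (suc n) (suc t) h =
  +-mono-≤ (𝟙≤1 (P? 0)) (∑-𝟙-≤ (P? ∘ suc) n t λ i p → s<s⁻¹ (h (suc i) p))
∑-𝟙-≤ P? (suc n) zero    h with P? 0
... | yes p = contradiction (h 0 p) λ ()
... | no  _ = ∑-𝟙-≤ (P? ∘ suc) n zero λ i p → contradiction (h (suc i) p) λ ()

∑-𝟙-≥ : ∀ {P : ℕ → Set} (P? : ∀ i → Dec (P i)) {n t} → t ≤ n → (∀ i → i < t → P i) →
        t ≤ ∑ (λ i → 𝟙 (P? i)) n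
∑-𝟙-≥ P? z≤n       h = z≤n
∑-𝟙-≥ P? (s≤s t≤n) h with P? 0
... | yes _ = s≤s (∑-𝟙-≥ (P? ∘ suc) t≤n λ i i<t → h (suc i) (s<s i<t))
... | no ¬p = contradiction (h 0 z<s) ¬p

-- The range is cut into consecutive blocks of lengths `a i`, with `r` the offset in block i. For
-- `a = A` and column heights `g` the right side is a convolution.
∑-partition-≤ : ∀ {f g : ℕ → ℕ} a m → (∀ i r → i < m → r < a i → f (∑ a i + r) ≤ g i) →
                ∑ f (∑ a m) ≤ ∑ (λ i → a i * g i) m
∑-partition-≤ a zero h = z≤n
∑-partition-≤ {f} {g} a (suc m) h = begin
  ∑ f (a 0 + ∑ (a ∘ suc) m)                            ≡⟨ ∑-split f (a 0) _ ⟩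
  ∑ f (a 0) + ∑ (λ x → f (a 0 + x)) (∑ (a ∘ suc) m)
    ≤⟨ +-mono-≤ (∑-const-≤ (g 0) (a 0) λ r → h 0 r z<s)
         (∑-partition-≤ (a ∘ suc) m λ i r i<m r<a →
           subst (λ x → f x ≤ g (suc i)) (+-assoc (a 0) _ r) (h (suc i) r (s<s i<m) r<a)) ⟩
  a 0 * g 0 + ∑ (λ i → a (suc i) * g (suc i)) m        ∎
  where open ≤-Reasoning

∑-partition-≥ : ∀ {f g : ℕ → ℕ} a m → (∀ i r → i < m → r < a i → g i ≤ f (∑ a i + r)) →
                ∑ (λ i → a i * g i) m ≤ ∑ f (∑ a m)
∑-partition-≥ a zero h = z≤n
∑-partition-≥ {f} {g} a (suc m) h = begin
  a 0 * g 0 + ∑ (λ i → a (suc i) * g (suc i)) m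
    ≤⟨ +-mono-≤ (∑-const-≥ (g 0) (a 0) λ r → h 0 r z<s)
         (∑-partition-≥ (a ∘ suc) m λ i r i<m r<a →
           subst (λ x → g (suc i) ≤ f x) (+-assoc (a 0) _ r) (h (suc i) r (s<s i<m) r<a)) ⟩
  ∑ f (a 0) + ∑ (λ x → f (a 0 + x)) (∑ (a ∘ suc) m)    ≡⟨ ∑-split f (a 0) _ ⟨
  ∑ f (a 0 + ∑ (a ∘ suc) m)                            ∎
  where open ≤-Reasoning

-- With this definition, conv f g (suc n) is f 0 * g (suc n) + conv (f ∘ suc) g n
-- by computation.
conv : (ℕ → ℕ) → (ℕ → ℕ) → ℕ → ℕ
conv f g n = ∑ (λ i → f i * g (n ∸ i)) (suc n)

conv-congˡ : ∀ {f f′} g n → (∀ i → i ≤ n → f i ≡ f′ i) → conv f g n ≡ conv f′ g n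
conv-congˡ g n h = ∑-cong (suc n) λ i i≤n → cong (_* g (n ∸ i)) (h i (s≤s⁻¹ i≤n))

conv-+ˡ : ∀ f f′ g n → conv (λ i → f i + f′ i) g n ≡ conv f g n + conv f′ g n
conv-+ˡ f f′ g n = trans
  (∑-cong (suc n) λ i _ → *-distribʳ-+ (g (n ∸ i)) (f i) (f′ i))
  (∑-+ (λ i → f i * g (n ∸ i)) (λ i → f′ i * g (n ∸ i)) (suc n))

-- Splits off the last term, where computation splits off the first, for the induction in
-- `conv-comm`.
conv-snoc : ∀ f g n → conv f g (suc n) ≡ conv f (g ∘ suc) n + f (suc n) * g 0
conv-snoc f g zero =
  solve 2 (λ x y → x :+ (y :+ con 0) := x :+ con 0 :+ y) refl (f 0 * g 1) (f 1 * g 0)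
  where open +-*-Solver
conv-snoc f g (suc n) = trans
  (cong (_+_ (f 0 * g (suc (suc n)))) (conv-snoc (f ∘ suc) g n))
  (sym (+-assoc (f 0 * g (suc (suc n))) _ _))

conv-comm : ∀ f g n → conv f g n ≡ conv g f n
conv-comm f g zero    = cong (_+ 0) (*-comm (f 0) (g 0))
conv-comm f g (suc n) = begin
  f 0 * g (suc n) + conv (f ∘ suc) g n   ≡⟨ +-comm (f 0 * g (suc n)) _ ⟩
  conv (f ∘ suc) g n + f 0 * g (suc n)   ≡⟨ cong₂ _+_ (conv-comm (f ∘ suc) g n) (*-comm (f 0) _) ⟩
  conv g (f ∘ suc) n + g (suc n) * f 0   ≡⟨ conv-snoc g f n ⟨
  conv g f (suc n)                       ∎
  where open ≡-Reasoning

-- On generating functions the weight i is the operator x d/dx, and this is its product rule.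
conv-leibniz : ∀ f g n → conv (λ i → i * f i) g n + conv f (λ i → i * g i) n ≡ n * conv f g n
conv-leibniz f g n = begin
  conv (λ i → i * f i) g n + conv f (λ i → i * g i) n
    ≡⟨ ∑-+ (λ i → i * f i * g (n ∸ i)) (λ i → f i * ((n ∸ i) * g (n ∸ i))) (suc n) ⟨
  ∑ (λ i → i * f i * g (n ∸ i) + f i * ((n ∸ i) * g (n ∸ i))) (suc n)
    ≡⟨ ∑-cong (suc n) (λ i i≤n → trans (collect i (n ∸ i) (f i) (g (n ∸ i)))
         (cong (_* (f i * g (n ∸ i))) (m+[n∸m]≡n (s≤s⁻¹ i≤n)))) ⟩
  ∑ (λ i → n * (f i * g (n ∸ i))) (suc n)
    ≡⟨ ∑-* n (λ i → f i * g (n ∸ i)) (suc n) ⟩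
  n * conv f g n ∎
  where
  open ≡-Reasoning
  open +-*-Solver
  collect : ∀ i j x y → i * x * y + x * (j * y) ≡ (i + j) * (x * y)
  collect = solve 4 (λ i j x y → i :* x :* y :+ x :* (j :* y) := (i :+ j) :* (x :* y)) refl

-- Monotone ratios and squares

-- Chains the inequalities f k / g k ≤ f (k+1) / g (k+1) in cross-multiplied form, cancelling the
-- positive `g c`.
ratio-mono : ∀ (f g : ℕ → ℕ) .{{_ : ∀ {k} → NonZero (g k)}} N →
             (∀ k → k < N → f k * g (suc k) ≤ f (suc k) * g k) →
             ∀ {a c} → a ≤′ c → c ≤ N → f a * g c ≤ f c * g a
ratio-mono f g N step ≤′-refl c≤N = ≤-refl
ratio-mono f g N step {a} {suc c} (≤′-step a≤c) c<N = *-cancelʳ-≤ _ _ (g c) (begin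
  f a * g (suc c) * g c    ≡⟨ swap (f a) _ _ ⟩
  f a * g c * g (suc c)    ≤⟨ *-monoˡ-≤ (g (suc c)) (ratio-mono f g N step a≤c (<⇒≤ c<N)) ⟩
  f c * g a * g (suc c)    ≡⟨ swap (f c) _ _ ⟩
  f c * g (suc c) * g a    ≤⟨ *-monoˡ-≤ (g a) (step c c<N) ⟩
  f (suc c) * g c * g a    ≡⟨ swap (f (suc c)) _ _ ⟩
  f (suc c) * g a * g c    ∎)
  where
  open ≤-Reasoning
  open +-*-Solver
  swap : ∀ x y z → x * y * z ≡ x * z * y
  swap = solve 3 (λ x y z → x :* y :* z := x :* z :* y) refl

square : ℕ → ℕ
square x = x * x

square-mono : ∀ {x y} → x ≤ y → square x ≤ square y
square-mono x≤y = *-mono-≤ x≤y x≤y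

-- The staircase: A k is D a_k and S k is D s_k, for k ≤ N, where D = A 0 is a common
-- denominator of a_0, …, a_N

module Staircase (N : ℕ) (A : ℕ → ℕ) .{{A₀≢0 : NonZero (A 0)}}
                 (recurrence : ∀ k → k < N → (2 + 2 * k) * A (suc k) ≡ (1 + 2 * k) * A k) where

  -- Partial sums and the area of the staircase

  S : ℕ → ℕ
  S = ∑ A

  D² : ℕ
  D² = square (A 0)

  S-suc≢0 : ∀ k → NonZero (S (suc k))
  S-suc≢0 k = >-nonZero (≤-trans (>-nonZero⁻¹ (A 0)) (m≤m+n (A 0) _))

  -- The index is shifted because S 0 = 0.
  square-S : ℕ → ℕ
  square-S k = square (S (suc k))

  square-S≢0 : ∀ k → NonZero (square-S k)
  square-S≢0 k = m*n≢0 (S (suc k)) (S (suc k)) {{S-suc≢0 k}} {{S-suc≢0 k}}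

  -- Mutual induction: adding `A k` leads from even to odd, and the recurrence rewrites the odd form
  -- in terms of `A (suc k)`, which is the next even form.
  S-even : ∀ k → k ≤ N → S k ≡ 2 * k * A k
  S-odd  : ∀ k → k ≤ N → S (suc k) ≡ (1 + 2 * k) * A k

  S-even zero    _   = refl
  S-even (suc k) k<N = trans (S-odd k (<⇒≤ k<N)) (trans (sym (recurrence k k<N))
    (cong (_* A (suc k)) (solve 1 (λ k → con 2 :+ con 2 :* k := con 2 :* (con 1 :+ k)) refl k)))
    where open +-*-Solver

  S-odd k k≤N = trans (∑-snoc A k) (trans (cong (_+ A k) (S-even k k≤N)) (+-comm _ (A k)))

  -- As S i = 2 i A i, symmetrising in the two factors replaces the weight 2 i by
  -- i + (n ∸ i) = n.
  conv-S-A : ∀ n → n ≤ N → conv S A n ≡ n * conv A A n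
  conv-S-A n n≤N = begin
    conv S A n                 ≡⟨ conv-congˡ A n (λ i i≤n → trans (S-even i (≤-trans i≤n n≤N)) (double i (A i))) ⟩
    conv (λ i → B i + B i) A n ≡⟨ conv-+ˡ B B A n ⟩
    conv B A n + conv B A n    ≡⟨ cong (conv B A n +_) (conv-comm B A n) ⟩
    conv B A n + conv A B n    ≡⟨ conv-leibniz A A n ⟩
    n * conv A A n             ∎
    where
    open ≡-Reasoning
    open +-*-Solver
    B : ℕ → ℕ
    B i = i * A i
    double : ∀ i x → 2 * i * x ≡ i * x + i * x
    double = solve 2 (λ i x → con 2 :* i :* x := i :* x :+ i :* x) refl

  conv-A-A : ∀ n → n ≤ N → conv A A n ≡ D²
  conv-A-A zero    _   = +-identityʳ D²
  conv-A-A (suc n) n<N = trans (*-cancelˡ-≡ _ _ (suc n) (begin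
    suc n * conv A A (suc n)    ≡⟨ conv-S-A (suc n) n<N ⟨
    -- By computation: the first term of `conv S A (suc n)` vanishes because `S 0` is 0.
    conv (S ∘ suc) A n          ≡⟨ conv-congˡ A n (λ i _ → ∑-snoc A i) ⟩
    conv (λ i → S i + A i) A n  ≡⟨ conv-+ˡ S A A n ⟩
    conv S A n + conv A A n     ≡⟨ cong (_+ conv A A n) (conv-S-A n (<⇒≤ n<N)) ⟩
    n * conv A A n + conv A A n ≡⟨ +-comm (n * conv A A n) _ ⟩
    suc n * conv A A n          ∎)) (conv-A-A n (<⇒≤ n<N))
    where open ≡-Reasoning

  -- Column i has width `A i` and height `S (n ∸ i)`, so the left side is the area of the cells (i ,
  -- j) with i + j < n.
  staircase-area : ∀ n → n ≤ N → conv A S n ≡ n * D²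
  staircase-area n n≤N =
    trans (conv-comm A S n) (trans (conv-S-A n n≤N) (cong (n *_) (conv-A-A n n≤N)))

  -- Growth of s_k² and the corners of the staircase

  square-S/suc-mono : ∀ {a c} → a ≤ c → c ≤ N → square-S a * suc c ≤ square-S c * suc a
  square-S/suc-mono a≤c = ratio-mono square-S suc N step (≤⇒≤′ a≤c)
    where
    step : ∀ k → k < N → square-S k * suc (suc k) ≤ square-S (suc k) * suc k
    step k k<N rewrite S-odd (suc k) k<N | S-even (suc k) k<N =
      -- The slack is exactly (k+1) x², as (2k+3)² = 4 (k+1) (k+2) + 1.
      m+n≤o⇒m≤o _ (≤-reflexive (solve 2 (λ k x →
        let y = con 2 :* (con 1 :+ k) :* x
            z = (con 1 :+ con 2 :* (con 1 :+ k)) :* x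
        in  y :* y :* (con 2 :+ k) :+ x :* x :* (con 1 :+ k) := z :* z :* (con 1 :+ k))
        refl k (A (suc k))))
      where open +-*-Solver

  odd/square-S-mono : ∀ {a c} → a ≤ c → c ≤ N → (1 + 2 * a) * square-S c ≤ (1 + 2 * c) * square-S a
  odd/square-S-mono a≤c = ratio-mono (λ k → 1 + 2 * k) square-S {{λ {k} → square-S≢0 k}} N step (≤⇒≤′ a≤c)
    where
    step : ∀ k → k < N → (1 + 2 * k) * square-S (suc k) ≤ (1 + 2 * suc k) * square-S k
    step k k<N rewrite S-odd (suc k) k<N | S-even (suc k) k<N =
      -- The slack is exactly (2k+3) x², as (2k+1) (2k+3) + 1 = (2k+2)².
      m+n≤o⇒m≤o _ (≤-reflexive (solve 2 (λ k x →
        let o = con 1 :+ con 2 :* (con 1 :+ k)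
            y = con 2 :* (con 1 :+ k) :* x
            z = o :* x
        in  (con 1 :+ con 2 :* k) :* (z :* z) :+ o :* (x :* x) := o :* (y :* y))
        refl k (A (suc k))))
      where open +-*-Solver

  -- The case a = 0, where `S 1` is `A 0`; it bounds the error 3 / s_{m+1}² by 3 / (m+1).
  square-S-≥ : ∀ m → m ≤ N → D² * suc m ≤ square-S m
  square-S-≥ m m≤N = subst₂ _≤_ (cong (λ x → square x * suc m) (+-identityʳ (A 0))) (*-identityʳ _)
    (square-S/suc-mono {0} {m} z≤n m≤N)

  -- As s_k² / k increases, each square on the left is at most the share of the right side
  -- proportional to its index, and the indices add up to i + j + 1.
  square-S-superadditive : ∀ i j → i + j ≤ N →
    square (S (suc i)) + square (S j) ≤ square (S (suc (i + j)))
  square-S-superadditive i zero    _ = ≤-reflexive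
    (trans (+-identityʳ _) (cong (square ∘ S ∘ suc) (sym (+-identityʳ i))))
  square-S-superadditive i (suc j) h = *-cancelʳ-≤ _ _ (suc c) (begin
    (square-S i + square-S j) * suc c          ≡⟨ *-distribʳ-+ (suc c) (square-S i) _ ⟩
    square-S i * suc c + square-S j * suc c    ≤⟨ +-mono-≤ (square-S/suc-mono (m≤m+n i (suc j)) h)
                                                    (square-S/suc-mono (≤-trans (n≤1+n j) (m≤n+m (suc j) i)) h) ⟩
    square-S c * suc i + square-S c * suc j    ≡⟨ *-distribˡ-+ (square-S c) (suc i) (suc j) ⟨
    square-S c * suc c                         ∎)
    where
    open ≤-Reasoning
    c = i + suc j

  -- For positive i and j, s_i² is at least (2i-1)/(2k-1) of s_k², likewise for j, and (2i-1) +
  -- (2j-1) = 2k exceeds 2k-1.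
  square-S-subadditive : ∀ i j k → i + j ≡ suc k → k ≤ N →
    square (S k) ≤ square (S i) + square (S j)
  square-S-subadditive zero j k refl _ = square-mono (∑-suc-≥ A k)
  square-S-subadditive (suc i) zero k refl _ =
    ≤-trans (square-mono (≤-trans (∑-suc-≥ A k) (≤-reflexive (cong (S ∘ suc) (+-identityʳ i)))))
            (m≤m+n _ _)
  square-S-subadditive (suc i) (suc j) k eq k≤N
    with refl ← trans (sym (suc-injective eq)) (+-suc i j) = *-cancelˡ-≤ {square-S c} (1 + 2 * c) (begin
    (1 + 2 * c) * square-S c                               ≤⟨ m≤n+m _ (square-S c) ⟩
    square-S c + (1 + 2 * c) * square-S c                  ≡⟨ collect i j (square-S c) ⟩
    (1 + 2 * i) * square-S c + (1 + 2 * j) * square-S c    ≤⟨ +-mono-≤ (odd/square-S-mono (m≤m+n i j) c≤N)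
                                                                (odd/square-S-mono (m≤n+m j i) c≤N) ⟩
    (1 + 2 * c) * square-S i + (1 + 2 * c) * square-S j    ≡⟨ *-distribˡ-+ (1 + 2 * c) (square-S i) _ ⟨
    (1 + 2 * c) * (square-S i + square-S j)                ∎)
    where
    open ≤-Reasoning
    open +-*-Solver
    c = i + j
    c≤N : c ≤ N
    c≤N = <⇒≤ k≤N
    collect : ∀ i j x → x + (1 + 2 * (i + j)) * x ≡ (1 + 2 * i) * x + (1 + 2 * j) * x
    collect = solve 3 (λ i j x → x :+ (con 1 :+ con 2 :* (i :+ j)) :* x
                := (con 1 :+ con 2 :* i) :* x :+ (con 1 :+ con 2 :* j) :* x) refl

  -- The staircase against the quarter discs

  -- A unit square of column i below height `S (n ∸ i)` has its far corner within (`S (suc i)` ,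
  -- `S (n ∸ i)`). The indices add up to n + 1, so superadditivity puts it in the disc.
  insideCount-≥ : ∀ n → n ≤ N → n * D² ≤ insideCount (S (suc n))
  insideCount-≥ n n≤N = begin
    n * D²                                      ≡⟨ staircase-area n n≤N ⟨
    conv A S n                                  ≤⟨ ∑-partition-≥ A (suc n) row ⟩
    ∑ (λ x → ∑ (λ y → 𝟙 (inside? K x y)) K) K    ≡⟨ count-∑ (inside? K) K ⟨
    insideCount K                               ∎
    where
    open ≤-Reasoning
    K = S (suc n)
    row : ∀ i r → i < suc n → r < A i → S (n ∸ i) ≤ ∑ (λ y → 𝟙 (inside? K (S i + r) y)) K
    row i r i≤n r<A = ∑-𝟙-≥ (inside? K (S i + r)) (∑-monoʳ-≤ A (≤-trans (m∸n≤m n i) (n≤1+n n))) λ y y<S → begin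
      square (suc (S i + r)) + square (suc y)     ≤⟨ +-mono-≤ (square-mono x<S) (square-mono y<S) ⟩
      square (S (suc i)) + square (S (n ∸ i))     ≤⟨ square-S-superadditive i (n ∸ i) (≤-trans (≤-reflexive i+[n∸i]≡n) n≤N) ⟩
      square (S (suc (i + (n ∸ i))))              ≡⟨ cong (square ∘ S ∘ suc) i+[n∸i]≡n ⟩
      square K                                    ∎
      where
      i+[n∸i]≡n : i + (n ∸ i) ≡ n
      i+[n∸i]≡n = m+[n∸m]≡n (s≤s⁻¹ i≤n)
      x<S : suc (S i + r) ≤ S (suc i)
      x<S = ≤-trans (+-monoʳ-< (S i) r<A) (≤-reflexive (sym (∑-snoc A i)))

  -- A unit square of column i at height `S (suc n ∸ i)` or above has its near corner beyond (`S i`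
  -- , `S (suc n ∸ i)`), which by subadditivity is not in the open disc.
  meetsCount-≤ : ∀ n → suc n ≤ N → meetsCount (S n) ≤ suc n * D²
  meetsCount-≤ n n<N = begin
    meetsCount K                                      ≡⟨ count-∑ (meets? K) K ⟩
    -- The outer range is enlarged to `S (2 + n)` to match the n + 2 columns of `conv A S (suc n)`,
    -- the last of height `S 0`, which is 0.
    ∑ (λ x → ∑ (λ y → 𝟙 (meets? K x y)) K) K          ≤⟨ ∑-monoʳ-≤ _ (∑-monoʳ-≤ A (m≤n+m n 2)) ⟩
    ∑ (λ x → ∑ (λ y → 𝟙 (meets? K x y)) K) (S (2 + n)) ≤⟨ ∑-partition-≤ A (2 + n) row ⟩
    conv A S (suc n)                                  ≡⟨ staircase-area (suc n) n<N ⟩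
    suc n * D²                                        ∎
    where
    open ≤-Reasoning
    K = S n
    row : ∀ i r → i < 2 + n → r < A i → ∑ (λ y → 𝟙 (meets? K (S i + r) y)) K ≤ S (suc n ∸ i)
    row i r i≤1+n _ = ∑-𝟙-≤ (meets? K (S i + r)) K (S (suc n ∸ i)) λ y meets → ≰⇒> λ S≤y →
      <⇒≱ meets (begin
        square K                                ≤⟨ square-S-subadditive i (suc n ∸ i) n (m+[n∸m]≡n (s≤s⁻¹ i≤1+n)) (<⇒≤ n<N) ⟩
        square (S i) + square (S (suc n ∸ i))   ≤⟨ +-mono-≤ (square-mono (m≤m+n (S i) r)) (square-mono S≤y) ⟩
        square (S i + r) + square y             ∎)

  -- Partial Wallis products between the two areas

  infixl 7 _/S²_
  _/S²_ : ℕ → ℕ → ℚ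
  x /S² k = (ℤ.+ x / square-S k) {{square-S≢0 k}}

  -- Since s_{m+1} : s_{m+2} = (2m+2) : (2m+3), the next Wallis factor turns (2m+1) / s_{m+1}² into
  -- (2m+3) / s_{m+2}².
  wallisProduct-≡ : ∀ m → m ≤ N → wallisProduct m ≡ ((1 + 2 * m) * D²) /S² m
  wallisProduct-≡ zero    _   = /-cross 1 1 (1 * D²) (square-S 0) {{_}} {{square-S≢0 0}}
    (solve 1 (λ a → con 1 :* ((a :+ con 0) :* (a :+ con 0)) := con 1 :* (a :* a) :* con 1) refl (A 0))
    where open +-*-Solver
  wallisProduct-≡ (suc m) m<N = trans
    (cong (ℚ._* wallisFactor (suc m)) (wallisProduct-≡ m (<⇒≤ m<N)))
    (/-*-/ ((1 + 2 * m) * D²) (square-S m) (2 * suc m * (2 * suc m)) ((2 * suc m ∸ 1) * (2 * suc m + 1))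
           ((1 + 2 * suc m) * D²) (square-S (suc m))
           {{square-S≢0 m}} {{denominator≢0}} {{square-S≢0 (suc m)}} cross)
    where
    denominator≢0 : NonZero ((2 * suc m ∸ 1) * (2 * suc m + 1))
    denominator≢0 = m*n≢0 (2 * suc m ∸ 1) (2 * suc m + 1)
      {{>-nonZero (≤-trans z<s (m≤n+m (suc (m + 0)) m))}}
    cross : (1 + 2 * m) * D² * (2 * suc m * (2 * suc m)) * square-S (suc m)
          ≡ (1 + 2 * suc m) * D² * (square-S m * ((2 * suc m ∸ 1) * (2 * suc m + 1)))
    cross rewrite S-odd (suc m) m<N | S-even (suc m) m<N = solve 3 (λ m d x →
        let o   = con 1 :+ con 2 :* m
            e   = con 2 :* (con 1 :+ m)
            o′  = con 1 :+ e
            -- The form to which `2 * suc m ∸ 1` computes.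
            e∸1 = m :+ (con 1 :+ (m :+ con 0))
        in  o :* d :* (e :* e) :* ((o′ :* x) :* (o′ :* x))
              := o′ :* d :* ((e :* x) :* (e :* x) :* (e∸1 :* (e :+ con 1))))
        refl m D² (A (suc m))
      where open +-*-Solver

  3D²/S²≤3/suc : ∀ m → m ≤ N → (3 * D²) /S² m ℚ.≤ ℤ.+ 3 / suc m
  3D²/S²≤3/suc m m≤N = /-mono-≤ (3 * D²) (square-S m) 3 (suc m) {{square-S≢0 m}}
    (≤-trans (≤-reflexive (*-assoc 3 D² (suc m))) (*-monoʳ-≤ 3 (square-S-≥ m m≤N)))

  /S²-homo-+ : ∀ x y m → x /S² m ℚ.+ y /S² m ≡ (x + y) /S² m
  /S²-homo-+ x y m = /-homo-+ x y (square-S m) {{square-S≢0 m}}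

  /S²-mono-≤ : ∀ {x y} m → x ≤ y → x /S² m ℚ.≤ y /S² m
  /S²-mono-≤ {x} {y} m x≤y = /-mono-≤ x (square-S m) y (square-S m)
    {{square-S≢0 m}} {{square-S≢0 m}} (*-monoˡ-≤ (square-S m) x≤y)

  ½*innerArea : ∀ m → ½ ℚ.* innerArea (S (suc m)) {{S-suc≢0 m}} ≡ (2 * insideCount (S (suc m))) /S² m
  ½*innerArea m = ½*4n/d (insideCount (S (suc m))) (square-S m) {{square-S≢0 m}}

  ½*outerArea : ∀ m → ½ ℚ.* outerArea (S (suc m)) {{S-suc≢0 m}} ≡ (2 * meetsCount (S (suc m))) /S² m
  ½*outerArea m = ½*4n/d (meetsCount (S (suc m))) (square-S m) {{square-S≢0 m}}

  wallisProduct≤½*innerArea : ∀ m → m ≤ N →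
    wallisProduct m ℚ.≤ ½ ℚ.* innerArea (S (suc m)) {{S-suc≢0 m}} ℚ.+ ℤ.+ 3 / suc m
  wallisProduct≤½*innerArea m m≤N = begin
    wallisProduct m                             ≡⟨ wallisProduct-≡ m m≤N ⟩
    ((1 + 2 * m) * D²) /S² m                    ≤⟨ /S²-mono-≤ m count-bound ⟩
    (2 * I + 3 * D²) /S² m                      ≡⟨ /S²-homo-+ (2 * I) (3 * D²) m ⟨
    (2 * I) /S² m ℚ.+ (3 * D²) /S² m            ≡⟨ cong (ℚ._+ (3 * D²) /S² m) (½*innerArea m) ⟨
    ½ ℚ.* area ℚ.+ (3 * D²) /S² m               ≤⟨ ℚ.+-monoʳ-≤ (½ ℚ.* area) (3D²/S²≤3/suc m m≤N) ⟩
    ½ ℚ.* area ℚ.+ ℤ.+ 3 / suc m                ∎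
    where
    open ℚ.≤-Reasoning
    I = insideCount (S (suc m))
    area = innerArea (S (suc m)) {{S-suc≢0 m}}
    -- The inner staircase has area m, so the defect is only D²; 3 D² is allowed to match the outer
    -- bound.
    count-bound : (1 + 2 * m) * D² ≤ 2 * I + 3 * D²
    count-bound = ≤-trans
      (m+n≤o⇒m≤o _ (≤-reflexive (solve 2 (λ m d → (con 1 :+ con 2 :* m) :* d :+ con 2 :* d
                       := con 2 :* (m :* d) :+ con 3 :* d) refl m D²)))
      (+-monoˡ-≤ (3 * D²) (*-monoʳ-≤ 2 (insideCount-≥ m m≤N)))
      where open +-*-Solver

  ½*outerArea≤wallisProduct : ∀ m → suc (suc m) ≤ N →
    ½ ℚ.* outerArea (S (suc m)) {{S-suc≢0 m}} ℚ.≤ wallisProduct m ℚ.+ ℤ.+ 3 / suc m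
  ½*outerArea≤wallisProduct m 2+m≤N = begin
    ½ ℚ.* outerArea (S (suc m)) {{S-suc≢0 m}}         ≡⟨ ½*outerArea m ⟩
    (2 * meetsCount (S (suc m))) /S² m                ≤⟨ /S²-mono-≤ m count-bound ⟩
    ((1 + 2 * m) * D² + 3 * D²) /S² m                 ≡⟨ /S²-homo-+ ((1 + 2 * m) * D²) (3 * D²) m ⟨
    ((1 + 2 * m) * D²) /S² m ℚ.+ (3 * D²) /S² m       ≡⟨ cong (ℚ._+ (3 * D²) /S² m) (wallisProduct-≡ m m≤N) ⟨
    wallisProduct m ℚ.+ (3 * D²) /S² m                ≤⟨ ℚ.+-monoʳ-≤ (wallisProduct m) (3D²/S²≤3/suc m m≤N) ⟩
    wallisProduct m ℚ.+ ℤ.+ 3 / suc m                 ∎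
    where
    open ℚ.≤-Reasoning
    m≤N : m ≤ N
    m≤N = ≤-trans (m≤n+m m 2) 2+m≤N
    -- The outer staircase has area m + 2, and 2 (m+2) = (2m+1) + 3 is the source of the constant 3.
    count-bound : 2 * meetsCount (S (suc m)) ≤ (1 + 2 * m) * D² + 3 * D²
    count-bound = ≤-trans (*-monoʳ-≤ 2 (meetsCount-≤ (suc m) 2+m≤N))
      (≤-reflexive (solve 2 (λ m d → con 2 :* ((con 2 :+ m) :* d)
                       := (con 1 :+ con 2 :* m) :* d :+ con 3 :* d) refl m D²))
      where open +-*-Solver

-- The common denominator

-- ∏_{c ≤ i < c+n} of 2i+1 for i < c+k and of 2i+2 for i ≥ c+k: for c = 0 this is
-- a_k times the common denominator 2 · 4 ⋯ 2n, provided that k ≤ n.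
scaled : (c n k : ℕ) → ℕ
scaled c zero    k       = 1
scaled c (suc n) zero    = (2 + 2 * c) * scaled (suc c) n zero
scaled c (suc n) (suc k) = (1 + 2 * c) * scaled (suc c) n k

scaled≢0 : ∀ c n k → NonZero (scaled c n k)
scaled≢0 c zero    k       = _
scaled≢0 c (suc n) zero    = m*n≢0 (2 + 2 * c) _ {{_}} {{scaled≢0 (suc c) n zero}}
scaled≢0 c (suc n) (suc k) = m*n≢0 (1 + 2 * c) _ {{_}} {{scaled≢0 (suc c) n k}}

-- The two products differ only in the factor at i = c + k, which is 2i+1 for `suc k` and 2i+2 for
-- `k`.
scaled-recurrence : ∀ c n k → k < n →
  (2 + 2 * (c + k)) * scaled c n (suc k) ≡ (1 + 2 * (c + k)) * scaled c n k
scaled-recurrence c (suc n) zero _ =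
  solve 2 (λ c x → (con 2 :+ con 2 :* (c :+ con 0)) :* ((con 1 :+ con 2 :* c) :* x)
                := (con 1 :+ con 2 :* (c :+ con 0)) :* ((con 2 :+ con 2 :* c) :* x)) refl c (scaled (suc c) n zero)
  where open +-*-Solver
scaled-recurrence c (suc n) (suc k) k<n rewrite +-suc c k = begin
  (2 + 2 * i) * ((1 + 2 * c) * scaled (suc c) n (suc k))    ≡⟨ swap (2 + 2 * i) (1 + 2 * c) (scaled (suc c) n (suc k)) ⟩
  (1 + 2 * c) * ((2 + 2 * i) * scaled (suc c) n (suc k))    ≡⟨ cong ((1 + 2 * c) *_) (scaled-recurrence (suc c) n k (s<s⁻¹ k<n)) ⟩
  (1 + 2 * c) * ((1 + 2 * i) * scaled (suc c) n k)          ≡⟨ swap (1 + 2 * c) (1 + 2 * i) (scaled (suc c) n k) ⟩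
  (1 + 2 * i) * ((1 + 2 * c) * scaled (suc c) n k)          ∎
  where
  open ≡-Reasoning
  open +-*-Solver
  i = suc (c + k)
  swap : ∀ x y z → x * (y * z) ≡ y * (x * z)
  swap = solve 3 (λ x y z → x :* (y :* z) := y :* (x :* z)) refl

-- Passage to the limit

wallis-sandwich : ∀ m → ∃[ K ] ∃[ K≢0 ]
  wallisProduct m ℚ.≤ ½ ℚ.* innerArea K {{K≢0}} ℚ.+ ℤ.+ 3 / suc m ×
  ½ ℚ.* outerArea K {{K≢0}} ℚ.≤ wallisProduct m ℚ.+ ℤ.+ 3 / suc m
wallis-sandwich m = S (suc m) , S-suc≢0 m ,
  wallisProduct≤½*innerArea m (m≤n+m m 2) , ½*outerArea≤wallisProduct m ≤-refl
  where
  -- The outer bound uses the staircase of area m + 2.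
  N = 2 + m
  open Staircase N (scaled 0 N) {{scaled≢0 0 N 0}} (scaled-recurrence 0 N)

3/suc-vanishes : ∀ δ → 0ℚ ℚ.< δ → ∃[ M ] ∀ m → M ≤ m → ℤ.+ 3 / suc m ℚ.≤ δ
-- The numerator of δ is at least 1, so δ ≥ 1 / `suc d`.
3/suc-vanishes δ@(mkℚ (ℤ.+ suc p) d _) 0<δ = 3 * suc d , λ m M≤m →
  subst (ℤ.+ 3 / suc m ℚ.≤_) (ℚ.↥p/↧p≡p δ) (/-mono-≤ 3 (suc m) (suc p) (suc d) (begin
    3 * suc d        ≤⟨ M≤m ⟩
    m                ≤⟨ n≤1+n m ⟩
    suc m            ≤⟨ m≤m+n (suc m) (p * suc m) ⟩
    suc p * suc m    ∎))
  where open ≤-Reasoning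
3/suc-vanishes (mkℚ (ℤ.+ zero) _ _) 0<δ with () ← ℚ.positive 0<δ .ℤ.Positive.pos
3/suc-vanishes (mkℚ ℤ.-[1+ _ ] _ _) 0<δ with () ← ℚ.positive 0<δ .ℤ.Positive.pos

wallis-error : ∀ δ → 0ℚ ℚ.< δ → ∃[ M ] ∀ m → M ≤ m → ∃[ L ] ∀ n → L ≤ n →
               ℚ.∣ wallisProduct m ℚ.- ½ ℚ.* approx π n ∣ ℚ.≤ δ
wallis-error δ 0<δ = proj₁ small , λ m M≤m → proj₁ inner , λ n L≤n →
  let K , K≢0 , lower , upper = wallis-sandwich m
      instance _ = K≢0
      3/m≤½δ = proj₂ small m M≤m
  in ∣-∣≤
    (begin
      wallisProduct m                                       ≤⟨ lower ⟩
      ½ ℚ.* innerArea K ℚ.+ ℤ.+ 3 / suc m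
        -- Passing from `innerArea K` to `approx π n` costs δ, halved by the factor ½; the other
        -- half of δ absorbs `3 / suc m`.
        ≤⟨ ℚ.+-mono-≤ (ℚ.*-monoˡ-≤-nonNeg ½ (proj₂ inner K (suc n) (m≤n⇒m≤1+n L≤n))) 3/m≤½δ ⟩
      ½ ℚ.* (approx π n ℚ.+ δ) ℚ.+ ½ ℚ.* δ                  ≡⟨ cong (ℚ._+ ½ ℚ.* δ) (ℚ.*-distribˡ-+ ½ (approx π n) δ) ⟩
      ½ ℚ.* approx π n ℚ.+ ½ ℚ.* δ ℚ.+ ½ ℚ.* δ              ≡⟨ ℚ.+-assoc (½ ℚ.* approx π n) _ _ ⟩
      ½ ℚ.* approx π n ℚ.+ (½ ℚ.* δ ℚ.+ ½ ℚ.* δ)            ≡⟨ cong (½ ℚ.* approx π n ℚ.+_) (½+½ δ) ⟩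
      ½ ℚ.* approx π n ℚ.+ δ                                ∎)
    (begin
      ½ ℚ.* approx π n                                      ≤⟨ ℚ.*-monoˡ-≤-nonNeg ½ (innerArea≤outerArea (suc n) K) ⟩
      ½ ℚ.* outerArea K                                     ≤⟨ upper ⟩
      wallisProduct m ℚ.+ ℤ.+ 3 / suc m                     ≤⟨ ℚ.+-monoʳ-≤ (wallisProduct m) (ℚ.≤-trans 3/m≤½δ ½δ≤δ) ⟩
      wallisProduct m ℚ.+ δ                                 ∎)
  where
  open ℚ.≤-Reasoning
  ½δ≤δ : ½ ℚ.* δ ℚ.≤ δ
  ½δ≤δ = subst₂ ℚ._≤_ (ℚ.+-identityʳ (½ ℚ.* δ)) (½+½ δ)
    (ℚ.+-monoʳ-≤ (½ ℚ.* δ) (ℚ.<⇒≤ (½*-pos 0<δ)))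
  small = 3/suc-vanishes (½ ℚ.* δ) (½*-pos 0<δ)
  inner = innerArea≤innerArea+ε δ 0<δ

mainTheorem1 : (λ m → fromℚ (wallisProduct m)) ⟶ ½ · π
mainTheorem1 ε (δ , 0<δ , N , δ≤ε) = proj₁ error , λ m M≤m →
  let L , bound = proj₂ error m M≤m
  -- One half of δ bounds the error, the other is the margin demanded by `_<ℝ_`.
  in ½ ℚ.* δ , ½*-pos 0<δ , N ⊔ L , λ n h → begin
    ℚ.∣ wallisProduct m ℚ.- ½ ℚ.* approx π n ∣ ℚ.+ ½ ℚ.* δ
      ≤⟨ ℚ.+-monoˡ-≤ (½ ℚ.* δ) (bound n (m⊔n≤o⇒n≤o N L h)) ⟩
    ½ ℚ.* δ ℚ.+ ½ ℚ.* δ    ≡⟨ ½+½ δ ⟩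
    δ                      ≡⟨ ℚ.+-identityˡ δ ⟨
    0ℚ ℚ.+ δ               ≤⟨ δ≤ε n (m⊔n≤o⇒m≤o N L h) ⟩
    approx ε n             ∎
  where
  open ℚ.≤-Reasoning
  error = wallis-error (½ ℚ.* δ) (½*-pos 0<δ)
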